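{- Let $\mathcal{N}=\langle P,T,\emptyset,\mathrm{Pre},\mathrm{Post},\mathrm{Inh},M_0,J,\mathit{true}\rangle$ be an ITPN. Let $\mathcal{S}_{\mathcal{N}}=(\mathcal{A},(M_0,J),\to)$ be its interval-based semantics and let $(\mathcal{C},(M_0,\mathbf{0}),\mapsto)$ be its clock-based semantics, where $\mathbf{0}$ is the clock valuation assigning $0$ to every transition. Then the relation $\approx\ \subseteq \mathcal{A}\times\mathcal{C}$ is a bisimulation from $(\mathcal{A},(M_0,J),\to)$ to $(\mathcal{C},(M_0,\mathbf{0}),\mapsto)$.
   Context: An ITPN (time Petri net with inhibitor arcs) is $\mathcal{N}=\langle P,T,\emptyset,\mathrm{Pre},\mathrm{Post},\mathrm{Inh},M_0,J,\mathit{true}\rangle$ where $P$ (places) and $T$ (transitions) are disjoint non-empty finite sets, $\mathrm{Pre},\mathrm{Post},\mathrm{Inh}:T\to\mathbb{N}^P$, $M_0\in\mathbb{N}^P$ is the initial marking, and $J$ assigns to each $t\in T$ an interval $J(t)$ with left endpoint $\downarrow J(t)\in\mathbb{Q}_{\ge 0}$ and right endpoint $\uparrow J(t)\in\mathbb{Q}_{\ge0}\cup\{\infty\}$. Time values are non-negative rationals; $\infty-\delta=\infty$. A marking is $M\in\mathbb{N}^P$, compared and added/subtracted pointwise. Transition $t$ is enabled in $M$ if $M\ge\mathrm{Pre}(t)$; inhibited in $M$ if there is $p$ with $\mathrm{Inh}(t)(p)>0$ and $M(p)\ge\mathrm{Inh}(t)(p)$; active if enabled and not inhibited. $t$ is newly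 enabled by firing $t_f$ in $M$ iff $\mathrm{Pre}(t)\le M-\mathrm{Pre}(t_f)+\mathrm{Post}(t_f)$ and ($t=t_f$ or not $\mathrm{Pre}(t)\le M-\mathrm{Pre}(t_f)$). Interval-based semantics: $\mathcal{A}=\mathbb{N}^P\times[T\to\mathrm{Intervals}]$ where an interval $I(t)$ has endpoints $\downarrow I(t)\in\mathbb{Q}$, $\uparrow I(t)\in\mathbb{Q}\cup\{\infty\}$. Time step $(M,I)\xrightarrow{\delta}(M,I')$ for $\delta\in\mathbb{Q}_{\ge0}$ iff for all $t\in T$: $I'(t)=I(t)$ if $t$ is enabled and inhibited in $M$; otherwise $\downarrow I'(t)=\max(0,\downarrow I(t)-\delta)$ and $\uparrow I'(t)=\uparrow I(t)-\delta$; and moreover $M\ge\mathrm{Pre}(t)$ implies $\uparrow I'(t)\ge0$. Discrete step $(M,I)\xrightarrow{t_f}(M',I')$ iff $t_f$ is active in $M$, $\downarrow I(t_f)=0$, $M'=M-\mathrm{Pre}(t_f)+\mathrm{Post}(t_f)$, and for all $t$, $I'(t)=J(t)$ if $t$ is newly enabled by firing $t_f$ in $M$, and $I'(t)=I(t)$ otherwise. $(M,I)\to(M',I')$ iff there exist $\delta$, $t_f$, $(M'',I'')$ with $(M,I)\xrightarrow{\delta}(M'',I'')\xrightarrow{t_f}(M',I')$. Clock-based semantics: $\mathcal{C}=\mathbb{N}^P\times[T\to\mathbb{Q}_{\ge0}]$ (states $(M,c)$, $c(t)$ the clock of $t$). Let $\mathrm{mte}(M,c)=\min\{\uparrow J(t)-c(t):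 t \text{ active in } M,\ \uparrow J(t)\ne\infty\}$ (and $\infty$ if this set is empty). Tick step: $(M,c)\to_{\mathrm{tick}}(M,c')$ iff there is $\tau\in\mathbb{Q}_{\ge0}$ with $\tau\le\mathrm{mte}(M,c)$ and $c'(t)=c(t)+\tau$ if $t$ is active in $M$, $c'(t)=c(t)$ otherwise. Apply step: $(M,c)\to_{\mathrm{apply}}(M',c')$ iff there is $t_f$ active in $M$ with $\downarrow J(t_f)\le c(t_f)\le\uparrow J(t_f)$, $M'=M-\mathrm{Pre}(t_f)+\mathrm{Post}(t_f)$, $c'(t_f)=0$, and for $t\ne t_f$: $c'(t)=c(t)$ if $\mathrm{Pre}(t)\le M-\mathrm{Pre}(t_f)$ and $c'(t)=0$ otherwise. $(M,c)\mapsto(M',c')$ iff there is $s$ with $(M,c)\to_{\mathrm{tick}}s\to_{\mathrm{apply}}(M',c')$. Relation $\approx$: $(M,I)\approx(M',c)$ iff $M'=M$ and for every $t\in T$: if $t$ is not enabled in $M$ then $c(t)=0$; otherwise, if $\uparrow J(t)\neq\infty$ then $c(t)=\uparrow J(t)-\uparrow I(t)$; if $\uparrow J(t)=\infty$ and $\downarrow I(t)>0$ then $c(t)=\downarrow J(t)-\downarrow I(t)$; if $\uparrow J(t)=\infty$ and $\downarrow I(t)\le 0$ then $c(t)$ is any value $\ge\downarrow J(t)$. A relation $\sim\subseteq A\times B$ is a bisimulation from $(A,a_0,\to_A)$ to $(B,b_0,\to_B)$ iff $a_0\sim b_0$ and for all $a\sim b$: if $a\to_A a'$ there is $b'$ with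 $b\to_B b'$ and $a'\sim b'$, and if $b\to_B b''$ there is $a''$ with $a\to_A a''$ and $a''\sim b''$.
   Formalization: The interval-based semantics is restricted to the states reachable from (M_0,J); over all of 𝒜 the claim is false, because ≈ leaves ↓I(t) unconstrained when ↑J(t)≠∞. -}

module Defs where

open import Data.Fin using (Fin)
open import Data.Fin.Properties using (all?; any?)
open import Data.List using (allFin; filter; map)
import Data.List.Extrema as Extrema
open import Data.Nat using (ℕ; NonZero)
import Data.Nat as ℕ
import Data.Nat.Properties as ℕ
open import Data.Product using (∃; ∃-syntax; _×_; _,_)
open import Data.Rational using (ℚ; 0ℚ; _+_; _-_; _⊔_; _≤_; _<_)
import Data.Rational.Properties as ℚ
open import Data.Refinement using (Refinement; value; _,_)
open import Data.Irrelevant using ([_])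
open import Data.Sum using (_⊎_)
open import Level using (0ℓ)
open import Relation.Binary.Bundles using (TotalOrder)
open import Relation.Binary.Core using (REL; Rel)
import Relation.Binary.Construct.Add.Supremum.NonStrict as AddSupremum
open import Relation.Binary.Construct.Closure.ReflexiveTransitive using (Star; ε)
open import Relation.Binary.PropositionalEquality using (_≡_; _≢_; _≗_)
open import Relation.Nullary using (¬_; Dec)
open import Relation.Nullary.Construct.Add.Supremum using (_⁺; ⊤⁺; [_]; ≡-dec)
open import Relation.Nullary.Decidable using (_×-dec_; ¬?)

------------------------------------------------------------------------
-- Transition systems and bisimulations

record TransitionSystem : Set₁ where
  field
    State : Set
    init  : State
    _⟶_   : Rel State 0ℓ

open TransitionSystem

record IsBisimulation (A B : TransitionSystem) (_∼_ : REL (State A) (State B) 0ℓ) : Set where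
  field
    initial : init A ∼ init B
    forth   : ∀ {a b a′} → a ∼ b → _⟶_ A a a′ → ∃[ b′ ] (_⟶_ B b b′ × a′ ∼ b′)
    back    : ∀ {a b b″} → a ∼ b → _⟶_ B b b″ → ∃[ a″ ] (_⟶_ A a a″ × a″ ∼ b″)

Reachable : (A : TransitionSystem) → State A → Set
Reachable A = Star (_⟶_ A) (init A)

reachablePart : TransitionSystem → TransitionSystem
reachablePart A = record
  { State = ∃ (Reachable A)
  ; init  = init A , ε
  ; _⟶_   = λ (s , _) (s′ , _) → _⟶_ A s s′
  }

------------------------------------------------------------------------
-- Time values and intervals

ℚ≥0 : Set
ℚ≥0 = Refinement ℚ (0ℚ ≤_)

0≥0 : ℚ≥0
0≥0 = 0ℚ , [ ℚ.≤-refl ]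

-- ℚ ∪ {∞}, with ∞ written ⊤⁺.
ℚ∞ : Set
ℚ∞ = ℚ ⁺

open AddSupremum _≤_ public using (_≤⁺_; ≤⁺-isTotalOrder-≡)

ℚ∞-totalOrder : TotalOrder 0ℓ 0ℓ 0ℓ
ℚ∞-totalOrder = record { isTotalOrder = ≤⁺-isTotalOrder-≡ ℚ.≤-isTotalOrder }

infixl 6 _-⁺_

_-⁺_ : ℚ∞ → ℚ → ℚ∞
[ u ] -⁺ δ = [ u - δ ]
⊤⁺    -⁺ δ = ⊤⁺

-- No order between the endpoints is imposed: letting time elapse drives the
-- right endpoint of a transition that is not enabled below the left one.
record Interval : Set where
  constructor ⟨_,_⟩
  field
    ↓ : ℚ
    ↑ : ℚ∞

open Interval public

------------------------------------------------------------------------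
-- Nets

record ITPN : Set where
  field
    #P #T : ℕ
    .{{#P-nonZero}} : NonZero #P
    .{{#T-nonZero}} : NonZero #T

  Place = Fin #P
  Transition = Fin #T
  Marking = Place → ℕ

  field
    Pre Post Inh : Transition → Marking
    M₀           : Marking
    J            : Transition → Interval
    ↓J-nonNeg    : ∀ t → 0ℚ ≤ ↓ (J t)
    ↑J-nonNeg    : ∀ t → [ 0ℚ ] ≤⁺ ↑ (J t)

module Semantics (N : ITPN) where
  open ITPN N

  infix  4 _≤ᴹ_
  infixl 6 _+ᴹ_ _∸ᴹ_

  _≤ᴹ_ : Rel Marking 0ℓ
  M ≤ᴹ M′ = ∀ p → M p ℕ.≤ M′ p

  _+ᴹ_ _∸ᴹ_ : Marking → Marking → Marking
  (M +ᴹ M′) p = M p ℕ.+ M′ p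
  (M ∸ᴹ M′) p = M p ℕ.∸ M′ p

  Enabled Inhibited Active : Marking → Transition → Set
  Enabled   M t = Pre t ≤ᴹ M
  Inhibited M t = ∃[ p ] (0 ℕ.< Inh t p × Inh t p ℕ.≤ M p)
  Active    M t = Enabled M t × ¬ Inhibited M t

  enabled? : ∀ M t → Dec (Enabled M t)
  enabled? M t = all? λ p → Pre t p ℕ.≤? M p

  inhibited? : ∀ M t → Dec (Inhibited M t)
  inhibited? M t = any? λ p → (0 ℕ.<? Inh t p) ×-dec (Inh t p ℕ.≤? M p)

  active? : ∀ M t → Dec (Active M t)
  active? M t = enabled? M t ×-dec ¬? (inhibited? M t)

  fire : Marking → Transition → Marking
  fire M t_f = M ∸ᴹ Pre t_f +ᴹ Post t_f

  NewlyEnabled : Marking → (t_f t : Transition) → Set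
  NewlyEnabled M t_f t =
    Pre t ≤ᴹ fire M t_f × (t ≡ t_f ⊎ ¬ (Pre t ≤ᴹ M ∸ᴹ Pre t_f))

  ----------------------------------------------------------------------
  -- Interval-based semantics

  𝒜 : Set
  𝒜 = Marking × (Transition → Interval)

  TimeStep : ℚ≥0 → Rel 𝒜 0ℓ
  TimeStep δ (M , I) (M′ , I′) = M′ ≗ M × ∀ t →
      (Enabled M t × Inhibited M t → I′ t ≡ I t)
    × (¬ (Enabled M t × Inhibited M t) →
         ↓ (I′ t) ≡ 0ℚ ⊔ (↓ (I t) - value δ)
       × ↑ (I′ t) ≡ ↑ (I t) -⁺ value δ)
    × (Enabled M t → [ 0ℚ ] ≤⁺ ↑ (I′ t))

  DiscreteStep : Transition → Rel 𝒜 0ℓ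
  DiscreteStep t_f (M , I) (M′ , I′) =
      Active M t_f
    × ↓ (I t_f) ≡ 0ℚ
    × M′ ≗ fire M t_f
    × (∀ t → (NewlyEnabled M t_f t → I′ t ≡ J t)
           × (¬ NewlyEnabled M t_f t → I′ t ≡ I t))

  _→ᴵ_ : Rel 𝒜 0ℓ
  a →ᴵ a′ = ∃[ δ ] ∃[ t_f ] ∃[ a″ ] (TimeStep δ a a″ × DiscreteStep t_f a″ a′)

  intervalSemantics : TransitionSystem
  intervalSemantics = record { State = 𝒜 ; init = M₀ , J ; _⟶_ = _→ᴵ_ }

  ----------------------------------------------------------------------
  -- Clock-based semantics

  𝒞 : Set
  𝒞 = Marking × (Transition → ℚ≥0)

  mte : 𝒞 → ℚ∞
  mte (M , c) = Extrema.min ℚ∞-totalOrder ⊤⁺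
    (map (λ t → ↑ (J t) -⁺ value (c t))
      (filter (λ t → active? M t ×-dec ¬? (≡-dec ℚ._≟_ (↑ (J t)) ⊤⁺))
        (allFin #T)))

  TickStep : Rel 𝒞 0ℓ
  TickStep (M , c) (M′ , c′) = M′ ≗ M × ∃[ τ ]
    ( [ value {P = 0ℚ ≤_} τ ] ≤⁺ mte (M , c)
    × (∀ t → (Active M t → value (c′ t) ≡ value (c t) + value τ)
           × (¬ Active M t → c′ t ≡ c t)))

  ApplyStep : Rel 𝒞 0ℓ
  ApplyStep (M , c) (M′ , c′) = ∃[ t_f ]
    ( Active M t_f
    × ↓ (J t_f) ≤ value (c t_f)
    × [ value (c t_f) ] ≤⁺ ↑ (J t_f)
    × M′ ≗ fire M t_f
    × c′ t_f ≡ 0≥0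
    × (∀ t → t ≢ t_f → (Pre t ≤ᴹ M ∸ᴹ Pre t_f → c′ t ≡ c t)
                     × (¬ (Pre t ≤ᴹ M ∸ᴹ Pre t_f) → c′ t ≡ 0≥0)))

  _↦_ : Rel 𝒞 0ℓ
  s ↦ s′ = ∃[ s″ ] (TickStep s s″ × ApplyStep s″ s′)

  clockSemantics : TransitionSystem
  clockSemantics = record { State = 𝒞 ; init = M₀ , (λ _ → 0≥0) ; _⟶_ = _↦_ }

  ----------------------------------------------------------------------
  -- The relation between the two semantics

  -- In the first clause for an enabled t, the equation c(t) = ↑J(t) - ↑I(t)
  -- with ↑J(t) ≠ ∞ is meaningful only when ↑I(t) is finite too, so this is
  -- part of the condition.
  ClockMatches : Transition → Interval → ℚ → Set
  ClockMatches t i x =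
      (∀ u → ↑ (J t) ≡ [ u ] → ∃[ v ] (↑ i ≡ [ v ] × x ≡ u - v))
    × (↑ (J t) ≡ ⊤⁺ → 0ℚ < ↓ i → x ≡ ↓ (J t) - ↓ i)
    × (↑ (J t) ≡ ⊤⁺ → ↓ i ≤ 0ℚ → ↓ (J t) ≤ x)

  infix 4 _≈_

  _≈_ : REL 𝒜 𝒞 0ℓ
  (M , I) ≈ (M′ , c) = M′ ≗ M × ∀ t →
      (¬ Enabled M t → value (c t) ≡ 0ℚ)
    × (Enabled M t → ClockMatches t (I t) (value (c t)))

  -- The interval semantics is taken on its reachable states.  On all of 𝒜 the
  -- relation ≈ is not a bisimulation: when ↑J(t) ≠ ∞ it leaves ↓I(t) free, so
  -- a state with I(t) = [0, ↑J(t)] is related to one with c(t) = 0 even if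
  -- ↓J(t) > 0.  Then t can fire at once from the former but not from the
  -- latter, where another transition with static interval [0, 0] may have to
  -- fire first.
  _≈ᴿ_ : REL (State (reachablePart intervalSemantics)) (State clockSemantics) 0ℓ
  (a , _) ≈ᴿ s = a ≈ s

{-# OPTIONS --safe #-}

-- Strengthen ≈ to the relation ∼ under which, for every enabled transition t,
-- the interval I(t) is the static interval J(t) aged by exactly c(t), and
-- ↑I(t) ≥ 0.  Unlike ≈, it determines ↓I(t) when ↑J(t) is finite, and it is a
-- bisimulation on all states: time steps and ticks match with the same delay,
-- because mte bounds the delay by what is left of the right endpoints, and
-- discrete steps match because newly enabled transitions are exactly those
-- whose clock is reset.  Hence every reachable interval state is ∼-related to
-- some clock state.  Two clock values matching the same interval age J(t) to
-- the same interval, so on reachable states ≈ and ∼ coincide.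
module Submission where

open import Defs

open import Data.Fin using (_≟_)
open import Data.Irrelevant using ([_])
open import Data.List using (allFin)
import Data.List.Extrema as Extrema
open import Data.List.Membership.Propositional.Properties using (∈-allFin; ∈-filter⁺)
import Data.List.Relation.Unary.All as All
import Data.List.Relation.Unary.All.Properties as All
import Data.Nat as ℕ
import Data.Nat.Properties as ℕ
open import Data.Product using (∃-syntax; _×_; _,_; proj₁; proj₂; map₂)
open import Data.Rational using (ℚ; 0ℚ; _+_; _-_; -_; _⊔_; _≤_; _<_)
import Data.Rational.Properties as ℚ
open import Data.Refinement using (value; _,_)
open import Data.Sum using (inj₁; inj₂; [_,_]′)
open import Function using (_∘_)
open import Relation.Binary.Bundles using (TotalOrder)
import Relation.Binary.Construct.Add.Supremum.NonStrict as AddSupremum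
open import Relation.Binary.Construct.Closure.ReflexiveTransitive using (Star; ε; _◅_; _◅◅_)
open import Relation.Binary.PropositionalEquality
  using (_≡_; _≢_; _≗_; refl; sym; trans; cong; cong₂; subst; subst₂; module ≡-Reasoning)
open import Relation.Nullary using (¬_; Dec; recompute; yes; no; contradiction)
open import Relation.Nullary.Construct.Add.Supremum using (⊤⁺; [_]; ≡-dec)
open import Relation.Nullary.Decidable using (_×-dec_; _⊎-dec_; ¬?)

open AddSupremum _≤_ using ([_]; _≤⊤⁺)
open import Algebra.Properties.Group ℚ.+-0-group
  using (⁻¹-anti-homo-//; //-rightDividesˡ)

-- Subtraction and order on rationals and on extended right endpoints.

p≤q⇒0≤q-p : ∀ {p q} → p ≤ q → 0ℚ ≤ q - p
p≤q⇒0≤q-p {p} {q} p≤q = subst (_≤ q - p) (ℚ.+-inverseʳ p) (ℚ.+-monoˡ-≤ (- p) p≤q)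

p≤q⇒p-q≤0 : ∀ {p q} → p ≤ q → p - q ≤ 0ℚ
p≤q⇒p-q≤0 {p} {q} p≤q = subst (p - q ≤_) (ℚ.+-inverseʳ q) (ℚ.+-monoˡ-≤ (- q) p≤q)

p-q≤0⇒p≤q : ∀ {p q} → p - q ≤ 0ℚ → p ≤ q
p-q≤0⇒p≤q {p} {q} p-q≤0 =
  subst₂ _≤_ (//-rightDividesˡ q p) (ℚ.+-identityˡ q) (ℚ.+-monoˡ-≤ q p-q≤0)

0≤q-p⇒p≤q : ∀ {p q} → 0ℚ ≤ q - p → p ≤ q
0≤q-p⇒p≤q {p} {q} 0≤q-p = subst₂ _≤_ (ℚ.+-identityˡ p) (//-rightDividesˡ p q) (ℚ.+-monoˡ-≤ p 0≤q-p)

p-[p-q]≡q : ∀ p q → p - (p - q) ≡ q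
p-[p-q]≡q p q = begin
  p - (p - q)  ≡⟨ cong (p +_) (⁻¹-anti-homo-// p q) ⟩
  p + (q - p)  ≡⟨ ℚ.+-comm p (q - p) ⟩
  q - p + p    ≡⟨ //-rightDividesˡ p q ⟩
  q            ∎
  where open ≡-Reasoning

p-q-r≡p-[q+r] : ∀ p q r → p - q - r ≡ p - (q + r)
p-q-r≡p-[q+r] p q r =
  trans (ℚ.+-assoc p (- q) (- r)) (cong (p +_) (sym (ℚ.neg-distrib-+ q r)))

-- Truncating before the subtraction changes nothing: its only trace is the term `0ℚ - q`, which is
-- at most zero and is absorbed by the outer maximum.
0⊔[[0⊔p]-q]≡0⊔[p-q] : ∀ p {q} → 0ℚ ≤ q → 0ℚ ⊔ ((0ℚ ⊔ p) - q) ≡ 0ℚ ⊔ (p - q)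
0⊔[[0⊔p]-q]≡0⊔[p-q] p {q} 0≤q = begin
  0ℚ ⊔ ((0ℚ ⊔ p) - q)         ≡⟨ cong (0ℚ ⊔_) (ℚ.mono-≤-distrib-⊔ (ℚ.+-monoˡ-≤ (- q)) 0ℚ p) ⟩
  0ℚ ⊔ ((0ℚ - q) ⊔ (p - q))   ≡⟨ ℚ.⊔-assoc 0ℚ (0ℚ - q) (p - q) ⟨
  (0ℚ ⊔ (0ℚ - q)) ⊔ (p - q)   ≡⟨ cong (_⊔ (p - q)) (ℚ.p≥q⇒p⊔q≡p (p≤q⇒p-q≤0 0≤q)) ⟩
  0ℚ ⊔ (p - q)                ∎
  where open ≡-Reasoning

[p]≤u⇒[0]≤u-p : ∀ {p u} → [ p ] ≤⁺ u → [ 0ℚ ] ≤⁺ u -⁺ p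
[p]≤u⇒[0]≤u-p {u = [ _ ]} [ p≤u ]   = [ p≤q⇒0≤q-p p≤u ]
[p]≤u⇒[0]≤u-p {u = ⊤⁺}    (_ ≤⊤⁺) = _ ≤⊤⁺

[0]≤u-p⇒[p]≤u : ∀ {p} u → [ 0ℚ ] ≤⁺ u -⁺ p → [ p ] ≤⁺ u
[0]≤u-p⇒[p]≤u [ _ ] [ 0≤u-p ] = [ 0≤q-p⇒p≤q 0≤u-p ]
[0]≤u-p⇒[p]≤u ⊤⁺    _         = _ ≤⊤⁺

-- Ageing of intervals by a delay.

infixl 6 _+≥0_

_+≥0_ : ℚ≥0 → ℚ≥0 → ℚ≥0
(p , [ 0≤p ]) +≥0 (q , [ 0≤q ]) = p + q , [ ℚ.+-mono-≤ 0≤p 0≤q ]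

-- The bound stored in a refinement is irrelevant; decidability of the order on rationals turns it
-- into a usable proof.
0≤value : (p : ℚ≥0) → 0ℚ ≤ value p
0≤value (p , [ 0≤p ]) = recompute (0ℚ ℚ.≤? p) 0≤p

-- This is the effect of a time step on a transition that is not frozen: only the left endpoint is
-- truncated at zero.
elapse : ℚ → Interval → Interval
elapse δ i = ⟨ 0ℚ ⊔ (↓ i - δ) , ↑ i -⁺ δ ⟩

elapse-0 : ∀ i → 0ℚ ≤ ↓ i → elapse 0ℚ i ≡ i
elapse-0 ⟨ l , u ⟩ 0≤l =
  cong₂ ⟨_,_⟩ (trans (cong (0ℚ ⊔_) (ℚ.+-identityʳ l)) (ℚ.p≤q⇒p⊔q≡q 0≤l)) (lemma u)
  where
  lemma : ∀ u → u -⁺ 0ℚ ≡ u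
  lemma [ u ] = cong [_] (ℚ.+-identityʳ u)
  lemma ⊤⁺    = refl

-- Ages add up, so a delay `δ` applied to an interval of age `x` corresponds to a clock moving from
-- `x` to `x + δ`.
elapse-elapse : ∀ x {δ} i → 0ℚ ≤ δ → elapse δ (elapse x i) ≡ elapse (x + δ) i
elapse-elapse x {δ} ⟨ l , u ⟩ 0≤δ = cong₂ ⟨_,_⟩
  (trans (0⊔[[0⊔p]-q]≡0⊔[p-q] (l - x) 0≤δ) (cong (0ℚ ⊔_) (p-q-r≡p-[q+r] l x δ)))
  (lemma u)
  where
  lemma : ∀ u → u -⁺ x -⁺ δ ≡ u -⁺ (x + δ)
  lemma [ u ] = cong [_] (p-q-r≡p-[q+r] u x δ)
  lemma ⊤⁺    = refl

elapse-past-↓ : ∀ {x} i → ↓ i ≤ x → ↓ (elapse x i) ≡ 0ℚ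
elapse-past-↓ i ↓i≤x = ℚ.p≥q⇒p⊔q≡p (p≤q⇒p-q≤0 ↓i≤x)

↓elapse≤0⇒↓≤ : ∀ {x} i → ↓ (elapse x i) ≤ 0ℚ → ↓ i ≤ x
↓elapse≤0⇒↓≤ {x} i ↓≤0 = p-q≤0⇒p≤q (ℚ.≤-trans (ℚ.p≤q⊔p 0ℚ (↓ i - x)) ↓≤0)

-- A positive left endpoint has not been truncated, so the age can be read off from it.
0<↓elapse⇒≡ : ∀ {x} i → 0ℚ < ↓ (elapse x i) → x ≡ ↓ i - ↓ (elapse x i)
0<↓elapse⇒≡ {x} i 0<↓ with ℚ.⊔-sel 0ℚ (↓ i - x)
... | inj₁ ≡0 = contradiction (subst (0ℚ <_) ≡0 0<↓) (ℚ.<-irrefl refl)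
... | inj₂ eq = trans (sym (p-[p-q]≡q (↓ i) x)) (cong (λ l → ↓ i - l) (sym eq))

-- Pairs a value defined by cases with its two equations, in the shape in which the step relations
-- state them.
choose : {P A : Set} → Dec P → (x y : A) → ∃[ z ] ((P → z ≡ x) × (¬ P → z ≡ y))
choose (yes p) x y = x , (λ _ → refl) , λ ¬p → contradiction p ¬p
choose (no ¬p) x y = y , (λ p → contradiction p ¬p) , λ _ → refl

module ClockExact (N : ITPN) where
  open ITPN N
  open Semantics N
  open Extrema ℚ∞-totalOrder using (min≤xs; v≤min⁺)

  -- Clock values matching a given interval.

  clockMatches : ∀ {t i x} → i ≡ elapse x (J t) → ClockMatches t i x
  clockMatches {t} {x = x} refl =
      (λ u ↑J≡u → u - x , cong (_-⁺ x) ↑J≡u , sym (p-[p-q]≡q u x))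
    , (λ _ → 0<↓elapse⇒≡ (J t))
    , (λ _ → ↓elapse≤0⇒↓≤ (J t))

  -- A finite right endpoint, or a positive left one, determines the clock. Otherwise both clocks
  -- have passed `↓ (J t)`, and every such age yields the interval from zero to infinity.
  clockMatches-elapse-unique : ∀ {t i x y} → ClockMatches t i x → ClockMatches t i y →
                               elapse x (J t) ≡ elapse y (J t)
  clockMatches-elapse-unique {t} {i} (fin-x , inf-x , past-x) (fin-y , inf-y , past-y)
    with J t
  ... | ⟨ l , [ u ] ⟩
    with v , ↑i≡v , refl ← fin-x u refl | v′ , ↑i≡v′ , refl ← fin-y u refl
    with refl ← trans (sym ↑i≡v) ↑i≡v′ = refl
  ... | ⟨ l , ⊤⁺ ⟩ with 0ℚ ℚ.<? ↓ i
  ...   | yes 0<↓i = cong (λ z → elapse z ⟨ l , ⊤⁺ ⟩)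
                       (trans (inf-x refl 0<↓i) (sym (inf-y refl 0<↓i)))
  ...   | no  0≮↓i = cong ⟨_, ⊤⁺ ⟩ (trans
            (elapse-past-↓ ⟨ l , ⊤⁺ ⟩ (past-x refl (ℚ.≮⇒≥ 0≮↓i)))
            (sym (elapse-past-↓ ⟨ l , ⊤⁺ ⟩ (past-y refl (ℚ.≮⇒≥ 0≮↓i)))))

  -- Markings up to pointwise equality, and the delay bound `mte`.

  ≤ᴹ-respʳ-≗ : ∀ {X M M′} → M ≗ M′ → X ≤ᴹ M → X ≤ᴹ M′
  ≤ᴹ-respʳ-≗ {X} M≗M′ X≤M p = subst (X p ℕ.≤_) (M≗M′ p) (X≤M p)

  ∸ᴹ-congˡ : ∀ {M M′} X → M ≗ M′ → M ∸ᴹ X ≗ M′ ∸ᴹ X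
  ∸ᴹ-congˡ X M≗M′ p = cong (ℕ._∸ X p) (M≗M′ p)

  fire-cong : ∀ {M M′} t → M ≗ M′ → fire M t ≗ fire M′ t
  fire-cong t M≗M′ p = cong (ℕ._+ Post t p) (∸ᴹ-congˡ (Pre t) M≗M′ p)

  Active-resp-≗ : ∀ {M M′ t} → M ≗ M′ → Active M t → Active M′ t
  Active-resp-≗ M≗M′ (enabled , ¬inhibited) =
      ≤ᴹ-respʳ-≗ M≗M′ enabled
    , λ (p , 0<Inh , Inh≤M′) → ¬inhibited (p , 0<Inh , subst (_ ℕ.≤_) (sym (M≗M′ p)) Inh≤M′)

  -- With `≤mte⁻`, this replaces the filtered minimum by a condition on all active transitions:
  -- those with an infinite right endpoint are filtered out, but bound nothing.
  ≤mte⁺ : ∀ {M x} c → (∀ t → Active M t → [ x ] ≤⁺ ↑ (J t) -⁺ value (c t)) →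
          [ x ] ≤⁺ mte (M , c)
  ≤mte⁺ c x≤ = v≤min⁺ (_ ≤⊤⁺)
    (All.map⁺ (All.map (λ {t} (active , _) → x≤ t active) (All.all-filter _ (allFin #T))))

  ≤mte⁻ : ∀ {M x} c → [ x ] ≤⁺ mte (M , c) →
          ∀ t → Active M t → [ x ] ≤⁺ ↑ (J t) -⁺ value (c t)
  ≤mte⁻ {x = x} c x≤mte t active with ≡-dec ℚ._≟_ (↑ (J t)) ⊤⁺
  ... | yes ↑J≡⊤ = subst (λ u → [ x ] ≤⁺ u -⁺ value (c t)) (sym ↑J≡⊤) (_ ≤⊤⁺)
  ... | no  ↑J≢⊤ = TotalOrder.trans ℚ∞-totalOrder x≤mte
          (All.lookup (All.map⁻ (min≤xs ⊤⁺ _)) (∈-filter⁺ _ (∈-allFin t) (active , ↑J≢⊤)))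

  -- The strengthened relation.

  infix 4 _∼_

  -- The sign condition on the right endpoint is part of the invariant because `mte` says nothing
  -- about inhibited transitions, whose intervals are frozen.
  record _∼_ (a : 𝒜) (s : 𝒞) : Set where
    constructor _,_
    field
      markings : proj₁ s ≗ proj₁ a
      clocks   : ∀ t →
          (¬ Enabled (proj₁ a) t → value (proj₂ s t) ≡ 0ℚ)
        × (Enabled (proj₁ a) t →
             proj₂ a t ≡ elapse (value (proj₂ s t)) (J t) × [ 0ℚ ] ≤⁺ ↑ (proj₂ a t))

  ∼⇒≈ : ∀ {a s} → a ∼ s → a ≈ s
  ∼⇒≈ (M′≗M , rel) = M′≗M , λ t →
    proj₁ (rel t) , λ enabled → clockMatches (proj₁ (proj₂ (rel t) enabled))

  -- The witness `s′` shows that each enabled interval is an ageing of the static one; uniqueness of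
  -- that ageing carries this over to the clocks of `s`.
  ≈⇒∼ : ∀ {a s s′} → a ∼ s′ → a ≈ s → a ∼ s
  ≈⇒∼ (_ , rel′) (M′≗M , rel) = M′≗M , λ t → proj₁ (rel t) , λ enabled →
    let I≡ , 0≤↑I = proj₂ (rel′ t) enabled in
      trans I≡ (clockMatches-elapse-unique (clockMatches I≡) (proj₂ (rel t) enabled))
    , 0≤↑I

  ∼-initial : (M₀ , J) ∼ (M₀ , λ _ → 0≥0)
  ∼-initial = (λ _ → refl) , λ t →
    (λ _ → refl) , λ _ → sym (elapse-0 (J t) (↓J-nonNeg t)) , ↑J-nonNeg t

  -- Time steps against ticks.

  Advance : Marking → ℚ≥0 → (c c′ : Transition → ℚ≥0) → Set
  Advance M τ c c′ = ∀ t → (Active M t → value (c′ t) ≡ value (c t) + value τ)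
                         × (¬ Active M t → c′ t ≡ c t)

  advance : ∀ M τ c → ∃[ c′ ] Advance M τ c c′
  advance M τ c = (λ t → proj₁ (clock t)) , λ t →
    cong value ∘ proj₁ (proj₂ (clock t)) , proj₂ (proj₂ (clock t))
    where
    clock : ∀ t → ∃[ x ] ((Active M t → x ≡ c t +≥0 τ) × (¬ Active M t → x ≡ c t))
    clock t = choose (active? M t) (c t +≥0 τ) (c t)

  -- An uninhibited interval ages as its clock advances; an inhibited one is frozen while its clock
  -- stands still. Both directions use this and only have to supply the missing step.
  time-∼ : ∀ δ {M I M″ I″ K c K″ c″} → (M , I) ∼ (K , c) →
           TimeStep δ (M , I) (M″ , I″) → K″ ≗ K → Advance K δ c c″ →
           (M″ , I″) ∼ (K″ , c″)
  time-∼ δ {M} {I} {M″} {I″} {K} {c} {K″} {c″} (K≗M , rel) (M″≗M , step) K″≗K adv =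
      (λ p → trans (K″≗K p) (trans (K≗M p) (sym (M″≗M p))))
    , λ t → disabled t , λ enabled → exact t (≤ᴹ-respʳ-≗ M″≗M enabled)
    where
    disabled : ∀ t → ¬ Enabled M″ t → value (c″ t) ≡ 0ℚ
    disabled t ¬enabled = trans
      (cong value (proj₂ (adv t)
        (λ (enabled , _) → ¬enabled (≤ᴹ-respʳ-≗ (λ p → trans (K≗M p) (sym (M″≗M p))) enabled))))
      (proj₁ (rel t) (λ enabled → ¬enabled (≤ᴹ-respʳ-≗ (sym ∘ M″≗M) enabled)))

    exact : ∀ t → Enabled M t → I″ t ≡ elapse (value (c″ t)) (J t) × [ 0ℚ ] ≤⁺ ↑ (I″ t)
    exact t enabled
      with frozen , aged , 0≤↑I″ ← step t | I≡ , _ ← proj₂ (rel t) enabled | inhibited? M t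
    ... | yes inhibited = I″≡ , 0≤↑I″ enabled
      where
      open ≡-Reasoning
      I″≡ : I″ t ≡ elapse (value (c″ t)) (J t)
      I″≡ = begin
        I″ t                         ≡⟨ frozen (enabled , inhibited) ⟩
        I t                          ≡⟨ I≡ ⟩
        elapse (value (c t)) (J t)   ≡⟨ cong (λ x → elapse (value x) (J t)) (proj₂ (adv t)
                                          (λ active → proj₂ (Active-resp-≗ K≗M active) inhibited)) ⟨
        elapse (value (c″ t)) (J t)  ∎
    ... | no ¬inhibited = I″≡ , 0≤↑I″ enabled
      where
      open ≡-Reasoning
      I″≡ : I″ t ≡ elapse (value (c″ t)) (J t)
      I″≡ = begin
        I″ t                                            ≡⟨ cong₂ ⟨_,_⟩ (proj₁ (aged (¬inhibited ∘ proj₂)))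
                                                                       (proj₂ (aged (¬inhibited ∘ proj₂))) ⟩
        elapse (value δ) (I t)                          ≡⟨ cong (elapse (value δ)) I≡ ⟩
        elapse (value δ) (elapse (value (c t)) (J t))   ≡⟨ elapse-elapse (value (c t)) (J t) (0≤value δ) ⟩
        elapse (value (c t) + value δ) (J t)            ≡⟨ cong (λ x → elapse x (J t)) (proj₁ (adv t)
                                                             (Active-resp-≗ (sym ∘ K≗M) (enabled , ¬inhibited))) ⟨
        elapse (value (c″ t)) (J t)                     ∎

  timeStep⇒tickStep : ∀ δ {a a″ s} → a ∼ s → TimeStep δ a a″ →
                      ∃[ s″ ] (TickStep s s″ × a″ ∼ s″)
  timeStep⇒tickStep δ {s = K , c} a∼s@(K≗M , rel) step@(_ , step-t)
    with c″ , adv ← advance K δ c =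
      (K , c″)
    , ((λ _ → refl) , δ , ≤mte⁺ c within , adv)
    , time-∼ δ a∼s step (λ _ → refl) adv
    where
    within : ∀ t → Active K t → [ value δ ] ≤⁺ ↑ (J t) -⁺ value (c t)
    within t active
      with enabled , ¬inhibited ← Active-resp-≗ K≗M active
      with _ , aged , 0≤↑I″ ← step-t t =
      -- The time step leaves `↑ (I t)` minus `δ` nonnegative, and `↑ (I t)` is what the clock
      -- leaves of `↑ (J t)`.
      subst (λ i → [ value δ ] ≤⁺ ↑ i) (proj₁ (proj₂ (rel t) enabled))
        ([0]≤u-p⇒[p]≤u _
          (subst ([ 0ℚ ] ≤⁺_) (proj₂ (aged (¬inhibited ∘ proj₂))) (0≤↑I″ enabled)))

  tickStep⇒timeStep : ∀ {a s s″} → a ∼ s → TickStep s s″ →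
                      ∃[ δ ] ∃[ a″ ] (TimeStep δ a a″ × a″ ∼ s″)
  tickStep⇒timeStep {M , I} {K , c} a∼s@(K≗M , rel) (K″≗K , τ , τ≤mte , adv) =
    τ , (M , I″) , step , time-∼ τ a∼s step K″≗K adv
    where
    interval : ∀ t → ∃[ i ] ((Enabled M t × Inhibited M t → i ≡ I t)
                           × (¬ (Enabled M t × Inhibited M t) → i ≡ elapse (value τ) (I t)))
    interval t = choose (enabled? M t ×-dec inhibited? M t) (I t) (elapse (value τ) (I t))

    I″ : Transition → Interval
    I″ t = proj₁ (interval t)

    0≤↑I″ : ∀ t → Enabled M t → [ 0ℚ ] ≤⁺ ↑ (I″ t)
    0≤↑I″ t enabled
      with frozen , aged ← proj₂ (interval t) | I≡ , 0≤↑I ← proj₂ (rel t) enabled | inhibited? M t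
    ... | yes inhibited = subst (λ i → [ 0ℚ ] ≤⁺ ↑ i) (sym (frozen (enabled , inhibited))) 0≤↑I
    ... | no ¬inhibited = subst (λ i → [ 0ℚ ] ≤⁺ ↑ i) (sym (aged (¬inhibited ∘ proj₂)))
      ([p]≤u⇒[0]≤u-p (subst (λ i → [ value τ ] ≤⁺ ↑ i) (sym I≡)
        (≤mte⁻ c τ≤mte t (Active-resp-≗ (sym ∘ K≗M) (enabled , ¬inhibited)))))

    step : TimeStep τ (M , I) (M , I″)
    step = (λ _ → refl) , λ t → let frozen , aged = proj₂ (interval t) in
        frozen
      , (λ ¬frozen → cong ↓ (aged ¬frozen) , cong ↑ (aged ¬frozen))
      , 0≤↑I″ t

  -- Discrete steps against apply steps.

  Renew : Marking → Transition → (I I′ : Transition → Interval) → Set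
  Renew M t_f I I′ = ∀ t → (NewlyEnabled M t_f t → I′ t ≡ J t)
                         × (¬ NewlyEnabled M t_f t → I′ t ≡ I t)

  renew : ∀ M t_f I → ∃[ I′ ] Renew M t_f I I′
  renew M t_f I = (λ t → proj₁ (interval t)) , λ t → proj₂ (interval t)
    where
    interval : ∀ t → ∃[ i ] ((NewlyEnabled M t_f t → i ≡ J t) × (¬ NewlyEnabled M t_f t → i ≡ I t))
    interval t = choose
      (enabled? (fire M t_f) t ×-dec (t ≟ t_f ⊎-dec ¬? (enabled? (M ∸ᴹ Pre t_f) t)))
      (J t) (I t)

  Reset : Marking → Transition → (c c′ : Transition → ℚ≥0) → Set
  Reset M t_f c c′ = c′ t_f ≡ 0≥0
                   × (∀ t → t ≢ t_f → (Pre t ≤ᴹ M ∸ᴹ Pre t_f → c′ t ≡ c t)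
                                    × (¬ (Pre t ≤ᴹ M ∸ᴹ Pre t_f) → c′ t ≡ 0≥0))

  reset : ∀ M t_f c → ∃[ c′ ] Reset M t_f c c′
  reset M t_f c =
      (λ t → proj₁ (clock t))
    , proj₁ (proj₂ (clock t_f)) refl
    , λ t t≢t_f → let eq = proj₂ (proj₂ (clock t)) t≢t_f in
        (λ persistent → trans eq (proj₁ (proj₂ (other t)) persistent))
      , (λ ¬persistent → trans eq (proj₂ (proj₂ (other t)) ¬persistent))
    where
    other : ∀ t → ∃[ x ] ((Pre t ≤ᴹ M ∸ᴹ Pre t_f → x ≡ c t) × (¬ (Pre t ≤ᴹ M ∸ᴹ Pre t_f) → x ≡ 0≥0))
    other t = choose (enabled? (M ∸ᴹ Pre t_f) t) (c t) 0≥0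

    clock : ∀ t → ∃[ x ] ((t ≡ t_f → x ≡ 0≥0) × (t ≢ t_f → x ≡ proj₁ (other t)))
    -- The test for `t_f` comes first: the fired transition is reset even if the remaining tokens
    -- still enable it.
    clock t = choose (t ≟ t_f) 0≥0 (proj₁ (other t))

  -- A transition that is fired, or not enabled by the intermediate marking, restarts at age zero on
  -- both sides; any other keeps both its interval and its clock.
  fire-∼ : ∀ {t_f M I M′ I′ K c K′ c′} → (M , I) ∼ (K , c) →
           M′ ≗ fire M t_f → Renew M t_f I I′ → K′ ≗ fire K t_f → Reset K t_f c c′ →
           (M′ , I′) ∼ (K′ , c′)
  fire-∼ {t_f} {M} {I} {M′} {I′} {K} {c} {K′} {c′}
    (K≗M , rel) M′≗ renewed K′≗ (reset-t_f , reset-other) =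
      (λ p → trans (K′≗ p) (trans (fire-cong t_f K≗M p) (sym (M′≗ p))))
    , λ t → related t (t ≟ t_f) (enabled? (M ∸ᴹ Pre t_f) t)
    where
    Related : Transition → Set
    Related t = (¬ Enabled M′ t → value (c′ t) ≡ 0ℚ)
              × (Enabled M′ t → I′ t ≡ elapse (value (c′ t)) (J t) × [ 0ℚ ] ≤⁺ ↑ (I′ t))

    restarted : ∀ t → c′ t ≡ 0≥0 → (Enabled M′ t → NewlyEnabled M t_f t) → Related t
    restarted t c′≡0 newly = (λ _ → cong value c′≡0) , λ enabled →
      let I′≡J = proj₁ (renewed t) (newly enabled) in
        trans I′≡J (trans (sym (elapse-0 (J t) (↓J-nonNeg t)))
          (cong (λ x → elapse (value x) (J t)) (sym c′≡0)))
      , subst (λ i → [ 0ℚ ] ≤⁺ ↑ i) (sym I′≡J) (↑J-nonNeg t)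

    related : ∀ t → Dec (t ≡ t_f) → Dec (Pre t ≤ᴹ M ∸ᴹ Pre t_f) → Related t
    related t (yes refl) _ = restarted t reset-t_f λ enabled → ≤ᴹ-respʳ-≗ M′≗ enabled , inj₁ refl
    related t (no t≢t_f) (no ¬persistent) = restarted t
      (proj₂ (reset-other t t≢t_f) (¬persistent ∘ ≤ᴹ-respʳ-≗ (∸ᴹ-congˡ (Pre t_f) K≗M)))
      λ enabled → ≤ᴹ-respʳ-≗ M′≗ enabled , inj₂ ¬persistent
    related t (no t≢t_f) (yes persistent) =
        -- Adding `Post t_f` cannot disable a transition enabled by the intermediate marking.
        (λ ¬enabled → contradiction
          (λ p → ℕ.≤-trans (persistent p) (subst (_ ℕ.≤_) (sym (M′≗ p)) (ℕ.m≤m+n _ (Post t_f p))))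
          ¬enabled)
      , λ _ →
          trans I′≡I (trans I≡ (cong (λ x → elapse (value x) (J t)) (sym c′≡c)))
        , subst (λ i → [ 0ℚ ] ≤⁺ ↑ i) (sym I′≡I) 0≤↑I
      where
      I′≡I : I′ t ≡ I t
      I′≡I = proj₂ (renewed t) λ (_ , newly) → [ t≢t_f , (λ ¬p → ¬p persistent) ]′ newly

      c′≡c : c′ t ≡ c t
      c′≡c = proj₁ (reset-other t t≢t_f) (≤ᴹ-respʳ-≗ (∸ᴹ-congˡ (Pre t_f) (sym ∘ K≗M)) persistent)

      exact : I t ≡ elapse (value (c t)) (J t) × [ 0ℚ ] ≤⁺ ↑ (I t)
      exact = proj₂ (rel t) λ p → ℕ.≤-trans (persistent p) (ℕ.m∸n≤m (M p) (Pre t_f p))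

      I≡ = proj₁ exact
      0≤↑I = proj₂ exact

  discreteStep⇒applyStep : ∀ {t_f a a′ s} → a ∼ s → DiscreteStep t_f a a′ →
                           ∃[ s′ ] (ApplyStep s s′ × a′ ∼ s′)
  discreteStep⇒applyStep {t_f} {s = K , c} a∼s@(K≗M , rel) (active , ↓I≡0 , M′≗ , renewed)
    with c′ , was-reset ← reset K t_f c | I≡ , 0≤↑I ← proj₂ (rel t_f) (proj₁ active) =
      (fire K t_f , c′)
    , ( t_f , Active-resp-≗ (sym ∘ K≗M) active
      -- A left endpoint aged to zero means that the clock has reached `↓ (J t_f)`.
      , ↓elapse≤0⇒↓≤ (J t_f) (ℚ.≤-reflexive (trans (cong ↓ (sym I≡)) ↓I≡0))
      , [0]≤u-p⇒[p]≤u _ (subst (λ i → [ 0ℚ ] ≤⁺ ↑ i) I≡ 0≤↑I)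
      , (λ _ → refl) , was-reset)
    , fire-∼ a∼s M′≗ renewed (λ _ → refl) was-reset

  applyStep⇒discreteStep : ∀ {a s s′} → a ∼ s → ApplyStep s s′ →
                           ∃[ t_f ] ∃[ a′ ] (DiscreteStep t_f a a′ × a′ ∼ s′)
  applyStep⇒discreteStep {M , I} a∼s@(K≗M , rel) (t_f , active , ↓J≤c , _ , K′≗ , was-reset)
    with I′ , renewed ← renew M t_f I | activeᴹ ← Active-resp-≗ K≗M active =
      t_f , (fire M t_f , I′)
    , ( activeᴹ
      , trans (cong ↓ (proj₁ (proj₂ (rel t_f) (proj₁ activeᴹ)))) (elapse-past-↓ (J t_f) ↓J≤c)
      , (λ _ → refl) , renewed)
    , fire-∼ a∼s (λ _ → refl) renewed K′≗ was-reset

  -- Assembling the bisimulation and restricting to reachable states.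

  ∼-isBisimulation : IsBisimulation intervalSemantics clockSemantics _∼_
  ∼-isBisimulation = record { initial = ∼-initial ; forth = forth ; back = back }
    where
    forth : ∀ {a s a′} → a ∼ s → a →ᴵ a′ → ∃[ s′ ] (s ↦ s′ × a′ ∼ s′)
    forth a∼s (δ , _ , _ , time , discrete)
      with s″ , tick , a″∼s″ ← timeStep⇒tickStep δ a∼s time
      with s′ , apply , a′∼s′ ← discreteStep⇒applyStep a″∼s″ discrete =
      s′ , (s″ , tick , apply) , a′∼s′

    back : ∀ {a s s′} → a ∼ s → s ↦ s′ → ∃[ a′ ] (a →ᴵ a′ × a′ ∼ s′)
    back a∼s (_ , tick , apply)
      with δ , a″ , time , a″∼s″ ← tickStep⇒timeStep a∼s tick
      with t_f , a′ , discrete , a′∼s′ ← applyStep⇒discreteStep a″∼s″ apply =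
      a′ , (δ , t_f , a″ , time , discrete) , a′∼s′

  open IsBisimulation ∼-isBisimulation using (forth; back)

  Star-∼ : ∀ {a a′ s} → a ∼ s → Star _→ᴵ_ a a′ → ∃[ s′ ] a′ ∼ s′
  Star-∼ a∼s ε = _ , a∼s
  Star-∼ a∼s (step ◅ steps) with _ , _ , a₁∼s₁ ← forth a∼s step = Star-∼ a₁∼s₁ steps

  reachable-≈⇒∼ : ∀ {a s} → Reachable intervalSemantics a → a ≈ s → a ∼ s
  reachable-≈⇒∼ reach a≈s = ≈⇒∼ (proj₂ (Star-∼ ∼-initial reach)) a≈s

theorem1 : (N : ITPN) → let open Semantics N in
    IsBisimulation (reachablePart intervalSemantics) clockSemantics _≈ᴿ_
theorem1 N = record
  { initial = ∼⇒≈ ∼-initial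
  ; forth   = λ { {_ , reach} a≈s step →
      map₂ (map₂ ∼⇒≈) (forth (reachable-≈⇒∼ reach a≈s) step) }
  ; back    = λ { {_ , reach} a≈s step →
      let a′ , step′ , a′∼s′ = back (reachable-≈⇒∼ reach a≈s) step in
      -- A state of the reachable part carries its run, so the run is extended by the new step.
      (a′ , reach ◅◅ step′ ◅ ε) , step′ , ∼⇒≈ a′∼s′ }
  }
  where
  open ClockExact N
  open IsBisimulation ∼-isBisimulation using (forth; back)
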